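{- The span of the elements $\mathbf{F}_{(\mathbf{a},u)}$ indexed by level $2$ parking functions $(\mathbf{a},u)$ is a subalgebra (for the product of the $\mathbf{F}$ basis). The span of the elements $\mathbf{G}_{(\mathbf{a},u)}$ indexed by level $2$ parking functions $(\mathbf{a},u)$ is a subcoalgebra of $\mathbf{PQSym}^{(2)}$.
   Context: A parking function of length $n$ is a word $\mathbf{a}=a_1\cdots a_n$ on $\{1,\ldots,n\}$ whose nondecreasing rearrangement $a_1'\cdots a_n'$ satisfies $a_i'\le i$. A $2$-colored parking function is a pair $(\mathbf{a},u)$ of a parking function and a word $u$ of the same length over the colors $0<1$. One says that $\mathbf{a}$ has a match at $b$ if $|\{i:a_i<b\}|=b-1$ and $|\{i:a_i\le b\}|\ge b$. A $2$-colored parking function $(\mathbf{a},u)$ is a level $2$ parking function if: (i) the only letters of $\mathbf{a}$ that can have color $1$ are the matches of $\mathbf{a}$; (ii) for every letter of $\mathbf{a}$ of color $1$, all the letters equal to it and to its left also have color $1$; (iii) every value occurring in $\mathbf{a}$ has color $0$ at least once. $\mathbf{PQSym}^{(2)}$ has basis $\mathbf{G}_{(\mathbf{a},u)}$ indexed by all $2$-colored parking functions, with coproduct $$\Delta\mathbf{G}_{(\mathbf{a},u)}=\sum_{(\mathbf{a},u)\in(\mathbf{a}',u')\Cup(\mathbf{a}'',u'')}\mathbf{G}_{(\mathbf{a}',u')}\otimes\mathbf{G}_{(\mathbf{a}'',u'')},$$ where $(\mathbf{a}',u')\Cup(\mathbf{a}'',u'')$ is the shifted shuffle: the shuffle of the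 words of biletters $(\mathbf{a}',u')$ and $(\mathbf{a}''[k],u'')$, $k=|\mathbf{a}'|$, with $\mathbf{a}''[k]$ obtained by adding $k$ to each letter of $\mathbf{a}''$ (colors follow their letters). The $\mathbf{F}_{(\mathbf{a},u)}$ form the dual basis of the $\mathbf{G}_{(\mathbf{a},u)}$ in the graded dual $(\mathbf{PQSym}^{(2)})^*$, with product $$\mathbf{F}_{(\mathbf{a}',u')}\mathbf{F}_{(\mathbf{a}'',u'')}=\sum_{(\mathbf{a},u)\in(\mathbf{a}',u')\Cup(\mathbf{a}'',u'')}\mathbf{F}_{(\mathbf{a},u)}.$$ -}

module Defs where

open import Algebra.Bundles using (CommutativeRing)
open import Algebra.Module.Bundles using (LeftModule)
import Algebra.Module.Construct.TensorUnit as TensorUnit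
open import Algebra.Module.Morphism.Structures
  using (module LeftModuleMorphisms)
import Algebra.Module.Morphism.Construct.Composition as Composition
import Algebra.Properties.CommutativeSemigroup as CommutativeSemigroupProperties
import Algebra.Properties.Group as GroupProperties
import Algebra.Properties.Ring as RingProperties
open import Data.Empty using (⊥)
open import Data.Fin.Base as Fin using (Fin; toℕ)
import Data.Fin.Properties as Fin
open import Data.Fin.Patterns using (0F; 1F)
open import Data.List.Base
  using (List; []; _∷_; _++_; map; length; lookup; filter; foldr; upTo;
         concatMap; cartesianProduct; cartesianProductWith)
open import Data.List.Properties
  using (length-map; length-++; ∷-injective; ∷-injectiveˡ; ∷-injectiveʳ;
         map-++; ≡-dec)
open import Data.List.Membership.Propositional using (_∈_; mapWith∈; lose)
open import Data.List.Membership.Propositional.Properties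
  using (∈-++⁻; ∈-map⁺; ∈-map⁻; ∈-upTo⁺; ∈-filter⁺; ∈-filter⁻;
         ∈-cartesianProduct⁺; ∈-cartesianProductWith⁺;
         ∈-cartesianProductWith⁻; ∈-concatMap⁺; map-mapWith∈; mapWith∈-id)
import Data.List.Membership.DecPropositional as DecMembership
open import Data.List.Relation.Binary.Disjoint.Propositional using (Disjoint)
open import Data.List.Relation.Binary.Permutation.Propositional
  using (_↭_; ↭-refl; ↭-reflexive; ↭-sym; ↭-trans; prep)
open import Data.List.Relation.Binary.Permutation.Propositional.Properties
  using (↭-length; All-resp-↭; ++⁺; map⁺; shift; ++-identityʳ)
open import Data.List.Relation.Binary.Equality.Propositional using (≋⇒≡)
import Data.List.Relation.Binary.Permutation.Propositional as Perm
open import Data.List.Relation.Unary.All as All using (All; []; _∷_)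
import Data.List.Relation.Unary.All.Properties as All
open import Data.List.Relation.Unary.AllPairs as AllPairs
  using (AllPairs; []; _∷_)
import Data.List.Relation.Unary.AllPairs.Properties as AllPairs
open import Data.List.Relation.Unary.Any using (here; there)
open import Data.List.Relation.Unary.Unique.Propositional using (Unique)
import Data.List.Relation.Unary.Unique.Propositional.Properties as Unique
import Data.List.Relation.Unary.Sorted.TotalOrder.Properties as Sorted
open import Data.List.Relation.Unary.Linked using (Linked; []; [-]; _∷_)
open import Data.Nat.Base using (ℕ; zero; suc; _+_; _≤_; _≥_; s≤s)
open import Data.Nat.Properties
  using (≤-decTotalOrder; ≤-totalOrder; _≤?_; _<?_; ≤-trans; +-monoʳ-≤;
         m≤m+n; m≤n+m; +-suc; +-mono-<; ≰⇒>; <⇒≱; suc-injective)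
import Data.Nat.Properties as ℕ
open import Data.List.Sort ≤-decTotalOrder using (sort; sort-↭; sort-↗)
open import Data.Product.Base using (Σ; ∃; _×_; _,_; proj₁; proj₂; map₁)
import Data.Product.Properties as Product
open import Data.Sum.Base using (inj₁; inj₂)
open import Function.Base using (_∘_)
open import Level using (Level; _⊔_)
open import Relation.Binary.Core using (Rel)
open import Relation.Binary.Definitions using (DecidableEquality)
open import Relation.Binary.PropositionalEquality
  using (_≡_; _≢_; refl; sym; trans; cong; subst; module ≡-Reasoning)
open import Relation.Nullary.Decidable using (Dec; yes; no; _×-dec_; recompute)
open import Relation.Nullary.Negation using (contradiction)
open import Relation.Unary using (Pred)

IsParking : List ℕ → Set
IsParking a = All (λ x → 1 ≤ x × x ≤ length a) a
            × (∀ i → lookup (sort a) i ≤ suc (toℕ i))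

parking? : ∀ a → Dec (IsParking a)
parking? a = All.all? (λ x → (1 ≤? x) ×-dec (x ≤? length a)) a
       ×-dec Fin.all? (λ i → lookup (sort a) i ≤? suc (toℕ i))

-- The condition |{i : aᵢ < b}| = b - 1 is written with suc, since b ∸ 1 would make
-- 0 satisfy it.
MatchAt : List ℕ → ℕ → Set
MatchAt a b = suc (length (filter (_<? b) a)) ≡ b
            × length (filter (_≤? b) a) ≥ b

Color : Set
Color = Fin 2

Biletter : Set
Biletter = ℕ × Color

letters : List Biletter → List ℕ
letters = map proj₁

-- The pair (a , u) is stored as the word of biletters (aᵢ , uᵢ).  The proof of
-- parking is irrelevant, so that equality is equality of words.
record ColoredPF : Set where
  constructor mkPF
  field
    word     : List Biletter
    .parking : IsParking (letters word)

  size : ℕ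
  size = length word

open ColoredPF public

record Level2 (p : ColoredPF) : Set where
  private
    letter : Fin (size p) → ℕ
    letter i = proj₁ (lookup (word p) i)

    color : Fin (size p) → Color
    color i = proj₂ (lookup (word p) i)

  field
    color1-match : ∀ i → color i ≡ 1F → MatchAt (letters (word p)) (letter i)
    color1-left  : ∀ i j → color i ≡ 1F → j Fin.< i → letter j ≡ letter i →
                   color j ≡ 1F
    color0-once  : ∀ i → (letter i , 0F) ∈ word p

shuffle : ∀ {a} {A : Set a} → List A → List A → List (List A)
shuffle []      v       = v ∷ []
shuffle (x ∷ u) []      = (x ∷ u) ∷ []
shuffle (x ∷ u) (y ∷ v) =
  map (x ∷_) (shuffle u (y ∷ v)) ++ map (y ∷_) (shuffle (x ∷ u) v)

_[_] : List Biletter → ℕ → List Biletter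
v [ k ] = map (map₁ (k +_)) v

shiftedShuffle : List Biletter → List Biletter → List (List Biletter)
shiftedShuffle u v = shuffle u (v [ length u ])

module _ {a} {A : Set a} where

  shuffle-↭ : ∀ (u v : List A) {w} → w ∈ shuffle u v → w ↭ u ++ v
  shuffle-↭ []      v       (here refl) = ↭-refl
  shuffle-↭ (x ∷ u) []      (here refl) = ↭-sym (++-identityʳ (x ∷ u))
  shuffle-↭ (x ∷ u) (y ∷ v) w∈ with ∈-++⁻ (map (x ∷_) (shuffle u (y ∷ v))) w∈
  ... | inj₁ w∈ˡ with ∈-map⁻ (x ∷_) w∈ˡ
  ...   | _ , w′∈ , refl = prep x (shuffle-↭ u (y ∷ v) w′∈)
  shuffle-↭ (x ∷ u) (y ∷ v) w∈ | inj₂ w∈ʳ with ∈-map⁻ (y ∷_) w∈ʳ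
  ...   | _ , w′∈ , refl =
    ↭-trans (prep y (shuffle-↭ (x ∷ u) v w′∈)) (↭-sym (shift y (x ∷ u) v))

  shuffle-unique : ∀ (u v : List A) → Disjoint u v → Unique (shuffle u v)
  shuffle-unique []      v       d = [] ∷ []
  shuffle-unique (x ∷ u) []      d = [] ∷ []
  shuffle-unique (x ∷ u) (y ∷ v) d = Unique.++⁺
    (Unique.map⁺ ∷-injectiveʳ (shuffle-unique u (y ∷ v) (λ (p , q) → d (there p , q))))
    (Unique.map⁺ ∷-injectiveʳ (shuffle-unique (x ∷ u) v (λ (p , q) → d (p , there q))))
    heads-differ
    where
    heads-differ : Disjoint (map (x ∷_) (shuffle u (y ∷ v)))
                            (map (y ∷_) (shuffle (x ∷ u) v))
    heads-differ (p , q) with ∈-map⁻ (x ∷_) p | ∈-map⁻ (y ∷_) q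
    ... | _ , _ , refl | _ , _ , eq = d (here refl , here (∷-injectiveˡ eq))

private
  letters-shift : ∀ k v → letters (v [ k ]) ≡ map (k +_) (letters v)
  letters-shift k []      = refl
  letters-shift k (_ ∷ v) = cong (_ ∷_) (letters-shift k v)

  shiftedShuffle-letters-↭ : ∀ u v {w} → w ∈ shiftedShuffle u v →
    letters w ↭ letters u ++ map (length u +_) (letters v)
  shiftedShuffle-letters-↭ u v {w} w∈ = ↭-trans (map⁺ proj₁ (shuffle-↭ u _ w∈))
    (↭-reflexive (trans (map-++ proj₁ u _)
                        (cong (letters u ++_) (letters-shift (length u) v))))

shiftedShuffle-length : ∀ u v {w} → w ∈ shiftedShuffle u v →
                        length w ≡ length u + length v
shiftedShuffle-length u v {w} w∈ = begin
  length w                           ≡⟨ ↭-length (shuffle-↭ u _ w∈) ⟩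
  length (u ++ v [ length u ])       ≡⟨ length-++ u ⟩
  length u + length (v [ length u ]) ≡⟨ cong (length u +_) (length-map _ v) ⟩
  length u + length v                ∎
  where open ≡-Reasoning

private
  Bounded : ℕ → List ℕ → Set
  Bounded k xs = ∀ i → lookup xs i ≤ suc (k + toℕ i)

  bounded-++ : ∀ k xs ys → Bounded k xs → Bounded (length xs + k) ys → Bounded k (xs ++ ys)
  bounded-++ k []       ys b b′ i        = b′ i
  bounded-++ k (x ∷ xs) ys b b′ Fin.zero = b Fin.zero
  bounded-++ k (x ∷ xs) ys b b′ (Fin.suc i) =
    subst (lookup (xs ++ ys) i ≤_) (cong suc (sym (+-suc k (toℕ i))))
      (bounded-++ (suc k) xs ys
        (λ j → subst (lookup xs j ≤_) (cong suc (+-suc k (toℕ j))) (b (Fin.suc j)))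
        (λ j → subst (λ m → lookup ys j ≤ suc (m + toℕ j)) (sym (+-suc (length xs) k)) (b′ j))
        i)

  bounded-map : ∀ k xs → Bounded 0 xs → Bounded k (map (k +_) xs)
  bounded-map k (x ∷ xs) b Fin.zero =
    subst (k + x ≤_) (+-suc k 0) (+-monoʳ-≤ k (b Fin.zero))
  bounded-map k (x ∷ xs) b (Fin.suc i) = go k xs 1 (λ j → b (Fin.suc j)) i
    where
    go : ∀ k xs m → (∀ j → lookup xs j ≤ suc (m + toℕ j)) →
         ∀ i → lookup (map (k +_) xs) i ≤ suc (k + (m + toℕ i))
    go k (x ∷ xs) m b Fin.zero =
      subst (k + x ≤_) (+-suc k (m + 0)) (+-monoʳ-≤ k (b Fin.zero))
    go k (x ∷ xs) m b (Fin.suc i) =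
      subst (λ z → lookup (map (k +_) xs) i ≤ suc (k + z)) (sym (+-suc m (toℕ i)))
        (go k xs (suc m) (λ j → subst (λ z → lookup xs j ≤ suc z) (+-suc m (toℕ j)) (b (Fin.suc j))) i)

  linked-map : ∀ k {xs} → Linked _≤_ xs → Linked _≤_ (map (k +_) xs)
  linked-map k []      = []
  linked-map k [-]     = [-]
  linked-map k (r ∷ l) = +-monoʳ-≤ k r ∷ linked-map k l

  linked-++ : ∀ k {xs ys} → Linked _≤_ xs → Linked _≤_ ys →
              All (_≤ k) xs → All (k ≤_) ys → Linked _≤_ (xs ++ ys)
  linked-++ k []      l′ _ _ = l′
  linked-++ k {ys = []}    [-] l′ (p ∷ []) _ = [-]
  linked-++ k {ys = _ ∷ _} [-] l′ (p ∷ []) (q ∷ _) = ≤-trans p q ∷ l′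
  linked-++ k (r ∷ l) l′ (_ ∷ ps) qs = r ∷ linked-++ k l l′ ps qs

  sort-length : ∀ xs → length (sort xs) ≡ length xs
  sort-length xs = ↭-length (sort-↭ xs)

shuffle-parking : ∀ a b {c} → c ↭ a ++ map (length a +_) b →
                  IsParking a → IsParking b → IsParking c
shuffle-parking a b {c} c↭ (a-range , a-sorted) (b-range , b-sorted) =
  All-resp-↭ (↭-sym c↭) (All.++⁺ (All.map rangeˡ a-range)
                                 (All.map⁺ (All.map rangeʳ b-range))) ,
  subst (Bounded 0) (sym sort-c)
    (bounded-++ 0 (sort a) (map (n +_) (sort b)) a-sorted
      (subst (λ m → Bounded m (map (n +_) (sort b)))
             (sym (trans (ℕ.+-identityʳ _) (sort-length a)))
             (bounded-map n (sort b) b-sorted)))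
  where
  n = length a

  length-c : length c ≡ n + length b
  length-c = trans (↭-length c↭) (trans (length-++ a) (cong (n +_) (length-map _ b)))

  rangeˡ : ∀ {x} → 1 ≤ x × x ≤ n → 1 ≤ x × x ≤ length c
  rangeˡ (p , q) = p , ≤-trans q (subst (n ≤_) (sym length-c) (m≤m+n n _))

  rangeʳ : ∀ {x} → 1 ≤ x × x ≤ length b → 1 ≤ n + x × n + x ≤ length c
  rangeʳ {x} (p , q) =
    ≤-trans p (m≤n+m x n) , subst (n + x ≤_) (sym length-c) (+-monoʳ-≤ n q)

  sort-c : sort c ≡ sort a ++ map (n +_) (sort b)
  sort-c = ≋⇒≡ (Sorted.↗↭↗⇒≋ ≤-totalOrder (sort-↗ c)
    (linked-++ n (sort-↗ a) (linked-map n (sort-↗ b))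
      (All-resp-↭ (↭-sym (sort-↭ a)) (All.map proj₂ a-range))
      (All.map⁺ (All.universal (m≤m+n n) (sort b))))
    (Perm.↭⇒↭ₛ (↭-trans (sort-↭ c) (↭-trans c↭
      (++⁺ (↭-sym (sort-↭ a)) (map⁺ (n +_) (↭-sym (sort-↭ b))))))))

shiftedShuffle-parking : ∀ u v {w} → w ∈ shiftedShuffle u v →
  IsParking (letters u) → IsParking (letters v) → IsParking (letters w)
shiftedShuffle-parking u v w∈ = shuffle-parking (letters u) (letters v)
  (subst (λ m → _ ↭ letters u ++ map (m +_) (letters v)) (sym (length-map proj₁ u))
         (shiftedShuffle-letters-↭ u v w∈))

infix 6 _⋒_

_⋒_ : ColoredPF → ColoredPF → List ColoredPF
mkPF u pu ⋒ mkPF v pv = mapWith∈ (shiftedShuffle u v) λ {w} w∈ →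
  mkPF w (shiftedShuffle-parking u v w∈ pu pv)

∅ : ColoredPF
∅ = mkPF [] ([] , λ i → subst (λ n → Fin n → lookup (sort []) i ≤ suc (toℕ i))
                              (sym (sort-length [])) (λ ()) i)

ColoredPF-≡ : ∀ {p q} → word p ≡ word q → p ≡ q
ColoredPF-≡ refl = refl

_≟-word_ : DecidableEquality (List Biletter)
_≟-word_ = ≡-dec (Product.≡-dec ℕ._≟_ Fin._≟_)

_≟_ : DecidableEquality ColoredPF
p ≟ q with word p ≟-word word q
... | yes eq = yes (ColoredPF-≡ eq)
... | no neq = no (neq ∘ cong word)

open DecMembership _≟_ using (_∈?_)

biletters : ℕ → List Biletter
biletters n = cartesianProduct (map suc (upTo n)) (0F ∷ 1F ∷ [])

wordsOfLength : ∀ {a} {A : Set a} → ℕ → List A → List (List A)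
wordsOfLength zero    xs = [] ∷ []
wordsOfLength (suc n) xs = cartesianProductWith _∷_ xs (wordsOfLength n xs)

parkingWords : List (List Biletter) → List ColoredPF
parkingWords []       = []
parkingWords (w ∷ ws) with parking? (letters w)
... | yes p = mkPF w p ∷ parkingWords ws
... | no  _ = parkingWords ws

coloredPFs : ℕ → List ColoredPF
coloredPFs n = parkingWords (wordsOfLength n (biletters n))

coloredPFs≤ : ℕ → List ColoredPF
coloredPFs≤ n = concatMap coloredPFs (upTo (suc n))

-- Every p and q with c ∈ p ⋒ q have size at most that of c.
factorisations : ColoredPF → List (ColoredPF × ColoredPF)
factorisations c = filter (λ (p , q) → c ∈? p ⋒ q)
  (cartesianProduct (coloredPFs≤ (size c)) (coloredPFs≤ (size c)))

isParking : ∀ p → IsParking (letters (word p))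
isParking (mkPF w p) = recompute (parking? (letters w)) p

words-⋒ : ∀ p q → map word (p ⋒ q) ≡ shiftedShuffle (word p) (word q)
words-⋒ (mkPF u pu) (mkPF v pv) =
  trans (map-mapWith∈ (shiftedShuffle u v) _ word) (mapWith∈-id _)

∈-⋒⁻ : ∀ p q {c} → c ∈ p ⋒ q → word c ∈ shiftedShuffle (word p) (word q)
∈-⋒⁻ p q {c} c∈ = subst (word c ∈_) (words-⋒ p q) (∈-map⁺ word c∈)

⋒-size : ∀ p q {c} → c ∈ p ⋒ q → size c ≡ size p + size q
⋒-size p q c∈ = shiftedShuffle-length (word p) (word q) (∈-⋒⁻ p q c∈)

⋒-unique : ∀ p q → Unique (p ⋒ q)
⋒-unique p q = AllPairs.map (λ w≢ p≡ → w≢ (cong word p≡)) (AllPairs.map⁻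
  (subst Unique (sym (words-⋒ p q)) (shuffle-unique (word p) _ disjoint)))
  where
  disjoint : Disjoint (word p) (word q [ size p ])
  disjoint (x∈p , x∈q) with ∈-map⁻ _ x∈q
  ... | (y , _) , y∈q , refl =
    <⇒≱ (ℕ.m<m+n (size p) (proj₁ (All.lookup (proj₁ (isParking q)) (∈-map⁺ proj₁ y∈q))))
        (subst (size p + y ≤_) (length-map proj₁ (word p))
          (proj₂ (All.lookup (proj₁ (isParking p)) (∈-map⁺ proj₁ x∈p))))

private
  wordsOfLength-length : ∀ {a} {A : Set a} n (xs : List A) {w} →
                         w ∈ wordsOfLength n xs → length w ≡ n
  wordsOfLength-length zero    xs (here refl) = refl
  wordsOfLength-length (suc n) xs w∈ with ∈-cartesianProductWith⁻ _∷_ xs _ w∈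
  ... | _ , _ , _ , w′∈ , refl = cong suc (wordsOfLength-length n xs w′∈)

  ∈-wordsOfLength : ∀ {a} {A : Set a} {xs : List A} w → All (_∈ xs) w →
                    w ∈ wordsOfLength (length w) xs
  ∈-wordsOfLength []      []       = here refl
  ∈-wordsOfLength (x ∷ w) (p ∷ ps) =
    ∈-cartesianProductWith⁺ _∷_ p (∈-wordsOfLength w ps)

  wordsOfLength-unique : ∀ {a} {A : Set a} n {xs : List A} → Unique xs →
                         Unique (wordsOfLength n xs)
  wordsOfLength-unique zero    u = [] ∷ []
  wordsOfLength-unique (suc n) u =
    Unique.cartesianProductWith⁺ _∷_ ∷-injective u (wordsOfLength-unique n u)

  ∈-parkingWords⁺ : ∀ {ws} p → word p ∈ ws → p ∈ parkingWords ws
  ∈-parkingWords⁺ {w ∷ ws} p p∈ with parking? (letters w) | p∈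
  ... | yes _ | here refl = here refl
  ... | no ¬p | here refl = contradiction (isParking p) ¬p
  ... | yes _ | there p∈′ = there (∈-parkingWords⁺ p p∈′)
  ... | no _  | there p∈′ = ∈-parkingWords⁺ p p∈′

  ∈-parkingWords⁻ : ∀ ws {p} → p ∈ parkingWords ws → word p ∈ ws
  ∈-parkingWords⁻ (w ∷ ws) p∈ with parking? (letters w) | p∈
  ... | yes _ | here refl = here refl
  ... | yes _ | there p∈′ = there (∈-parkingWords⁻ ws p∈′)
  ... | no _  | p∈′       = there (∈-parkingWords⁻ ws p∈′)

  parkingWords-unique : ∀ {ws} → Unique ws → Unique (parkingWords ws)
  parkingWords-unique {[]}     [] = []
  parkingWords-unique {w ∷ ws} (w∉ ∷ u) with parking? (letters w)
  ... | yes _ = All.tabulate (λ q∈ p≡ →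
                  All.lookup w∉ (∈-parkingWords⁻ ws q∈) (cong word p≡))
                ∷ parkingWords-unique u
  ... | no _  = parkingWords-unique u

coloredPFs-size : ∀ n {p} → p ∈ coloredPFs n → size p ≡ n
coloredPFs-size n p∈ = wordsOfLength-length n (biletters n) (∈-parkingWords⁻ _ p∈)

coloredPFs-complete : ∀ p → p ∈ coloredPFs (size p)
coloredPFs-complete p = ∈-parkingWords⁺ p (∈-wordsOfLength (word p)
  (All.tabulate λ {(x , u)} x∈ →
    ∈-cartesianProduct⁺ (letter∈ (All.lookup (proj₁ (isParking p)) (∈-map⁺ proj₁ x∈)))
                        (color∈ u)))
  where
  letter∈ : ∀ {x} → 1 ≤ x × x ≤ length (letters (word p)) →
            x ∈ map suc (upTo (size p))
  letter∈ {suc x} (_ , x≤) =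
    ∈-map⁺ suc (∈-upTo⁺ (subst (suc x ≤_) (length-map proj₁ (word p)) x≤))

  color∈ : ∀ u → u ∈ 0F ∷ 1F ∷ []
  color∈ 0F = here refl
  color∈ 1F = there (here refl)

coloredPFs-unique : ∀ n → Unique (coloredPFs n)
coloredPFs-unique n = parkingWords-unique (wordsOfLength-unique n
  (Unique.cartesianProduct⁺ (Unique.map⁺ suc-injective (Unique.upTo⁺ n))
                            (((λ ()) ∷ []) ∷ [] ∷ [])))

coloredPFs≤-unique : ∀ n → Unique (coloredPFs≤ n)
coloredPFs≤-unique n = Unique.concat⁺ {xss = map coloredPFs (upTo (suc n))}
  (All.map⁺ (All.universal coloredPFs-unique (upTo (suc n))))
  (AllPairs.map⁺ (AllPairs.map disjoint (Unique.upTo⁺ (suc n))))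
  where
  disjoint : ∀ {i j} → i ≢ j → Disjoint (coloredPFs i) (coloredPFs j)
  disjoint i≢j (p∈ , p∈′) =
    i≢j (trans (sym (coloredPFs-size _ p∈)) (coloredPFs-size _ p∈′))

factorisations-unique : ∀ c → Unique (factorisations c)
factorisations-unique c = Unique.filter⁺ _
  (Unique.cartesianProduct⁺ (coloredPFs≤-unique (size c)) (coloredPFs≤-unique (size c)))

∈-factorisations⁻ : ∀ {c p q} → (p , q) ∈ factorisations c → c ∈ p ⋒ q
∈-factorisations⁻ {c} pq∈ = proj₂ (∈-filter⁻ (λ (p , q) → c ∈? p ⋒ q)
  {xs = cartesianProduct (coloredPFs≤ (size c)) (coloredPFs≤ (size c))} pq∈)

∈-factorisations⁺ : ∀ {c p q} → c ∈ p ⋒ q → (p , q) ∈ factorisations c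
∈-factorisations⁺ {c} {p} {q} c∈ = ∈-filter⁺ (λ (p , q) → c ∈? p ⋒ q)
  (∈-cartesianProduct⁺
    (bounded p (subst (size p ≤_) (sym (⋒-size p q c∈)) (m≤m+n _ _)))
    (bounded q (subst (size q ≤_) (sym (⋒-size p q c∈)) (m≤n+m _ (size p)))))
  c∈
  where
  bounded : ∀ p → size p ≤ size c → p ∈ coloredPFs≤ (size c)
  bounded p p≤ = ∈-concatMap⁺ coloredPFs
    (lose (∈-upTo⁺ (s≤s p≤)) (coloredPFs-complete p))

module Modules {r ℓr} (R : CommutativeRing r ℓr) where

  private
    module R = CommutativeRing R

    variable
      m ℓm n ℓn x e i p : Level

  module _ (M : LeftModule R.ring m ℓm) where
    private module M = LeftModule M

    sumᴹ : ∀ {a} {A : Set a} → (A → M.Carrierᴹ) → List A → M.Carrierᴹ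
    sumᴹ f = foldr (λ a s → f a M.+ᴹ s) M.0ᴹ

    record IsSubmodule (P : Pred M.Carrierᴹ p) : Set (r ⊔ m ⊔ ℓm ⊔ p) where
      field
        resp      : ∀ {x y} → x M.≈ᴹ y → P x → P y
        0ᴹ-closed : P M.0ᴹ
        +ᴹ-closed : ∀ {x y} → P x → P y → P (x M.+ᴹ y)
        *ₗ-closed : ∀ k {x} → P x → P (k M.*ₗ x)

    data Span {I : Set i} (v : I → M.Carrierᴹ) : Pred M.Carrierᴹ (r ⊔ m ⊔ ℓm ⊔ i) where
      gen  : ∀ j → Span v (v j)
      zero : Span v M.0ᴹ
      add  : ∀ {x y} → Span v x → Span v y → Span v (x M.+ᴹ y)
      smul : ∀ k {x} → Span v x → Span v (k M.*ₗ x)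
      resp : ∀ {x y} → x M.≈ᴹ y → Span v x → Span v y

    record IsSubalgebra (_·_ : M.Carrierᴹ → M.Carrierᴹ → M.Carrierᴹ) (1ᴹ : M.Carrierᴹ)
                        (P : Pred M.Carrierᴹ p) : Set (r ⊔ m ⊔ ℓm ⊔ p) where
      field
        isSubmodule : IsSubmodule P
        1ᴹ-closed   : P 1ᴹ
        ·-closed    : ∀ {x y} → P x → P y → P (x · y)

  record LinearMap (M : LeftModule R.ring m ℓm) (N : LeftModule R.ring n ℓn) :
                   Set (r ⊔ m ⊔ ℓm ⊔ n ⊔ ℓn) where
    private
      module M = LeftModule M
      module N = LeftModule N
    open LeftModuleMorphisms M.rawLeftModule N.rawLeftModule
    infixl 20 _⟨$⟩_
    field
      _⟨$⟩_                    : M.Carrierᴹ → N.Carrierᴹ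
      isLeftModuleHomomorphism : IsLeftModuleHomomorphism _⟨$⟩_
    open IsLeftModuleHomomorphism isLeftModuleHomomorphism public

  open LinearMap public using (_⟨$⟩_)

  _∘ₗ_ : ∀ {m₁ ℓm₁ m₂ ℓm₂ m₃ ℓm₃} {M₁ : LeftModule R.ring m₁ ℓm₁}
         {M₂ : LeftModule R.ring m₂ ℓm₂} {M₃ : LeftModule R.ring m₃ ℓm₃} →
         LinearMap M₂ M₃ → LinearMap M₁ M₂ → LinearMap M₁ M₃
  _∘ₗ_ {M₃ = M₃} g f = record
    { isLeftModuleHomomorphism = Composition.isLeftModuleHomomorphism
        (LeftModule.≈ᴹ-trans M₃)
        (LinearMap.isLeftModuleHomomorphism f)
        (LinearMap.isLeftModuleHomomorphism g) }

  Functional : LeftModule R.ring m ℓm → Set (r ⊔ ℓr ⊔ m ⊔ ℓm)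
  Functional M = LinearMap M TensorUnit.leftModule

  module _ (M : LeftModule R.ring m ℓm) (N : LeftModule R.ring n ℓn) where
    private
      module M = LeftModule M
      module N = LeftModule N
      open GroupProperties N.+ᴹ-group using (inverseˡ-unique)

    mkLinearMap : (f : M.Carrierᴹ → N.Carrierᴹ) →
                  (∀ {x y} → x M.≈ᴹ y → f x N.≈ᴹ f y) →
                  (∀ x y → f (x M.+ᴹ y) N.≈ᴹ f x N.+ᴹ f y) →
                  (∀ k x → f (k M.*ₗ x) N.≈ᴹ k N.*ₗ f x) →
                  LinearMap M N
    mkLinearMap f f-cong f-+ f-* = record
      { _⟨$⟩_ = f
      ; isLeftModuleHomomorphism = record
        { +ᴹ-isGroupHomomorphism = record
          { isMonoidHomomorphism = record
            { isMagmaHomomorphism = record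
              { isRelHomomorphism = record { cong = f-cong }
              ; homo = f-+
              }
            ; ε-homo = f-0
            }
          ; ⁻¹-homo = λ x → inverseˡ-unique (f (M.-ᴹ x)) (f x)
              (N.≈ᴹ-trans (N.≈ᴹ-sym (f-+ _ _))
                          (N.≈ᴹ-trans (f-cong (M.-ᴹ‿inverseˡ x)) f-0))
          }
        ; *ₗ-homo = f-*
        }
      }
      where
      f-0 : f M.0ᴹ N.≈ᴹ N.0ᴹ
      f-0 = N.≈ᴹ-trans (f-cong (M.≈ᴹ-sym (M.*ₗ-zeroˡ M.0ᴹ)))
                       (N.≈ᴹ-trans (f-* R.0# M.0ᴹ) (N.*ₗ-zeroˡ _))

    sumᴹ-homo : (f : LinearMap M N) → ∀ {a} {A : Set a} (g : A → M.Carrierᴹ) xs →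
                f ⟨$⟩ (sumᴹ M g xs) N.≈ᴹ sumᴹ N (λ a → f ⟨$⟩ g a) xs
    sumᴹ-homo f g []       = LinearMap.0ᴹ-homo f
    sumᴹ-homo f g (a ∷ xs) = N.≈ᴹ-trans (LinearMap.+ᴹ-homo f _ _)
                                        (N.+ᴹ-congˡ (sumᴹ-homo f g xs))

  -- Presented E below is the module generated by X subject to the relations E.
  infixl 6 _⊕_
  infixr 7 _⊛_

  data Term (X : Set x) : Set (r ⊔ x) where
    gen : X → Term X
    𝟎   : Term X
    _⊕_ : Term X → Term X → Term X
    _⊛_ : R.Carrier → Term X → Term X

  module _ {X : Set x} (E : Rel (Term X) e) where

    infix 4 _≈ᵀ_

    data _≈ᵀ_ : Rel (Term X) (r ⊔ ℓr ⊔ x ⊔ e) where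
      rel       : ∀ {s t} → E s t → s ≈ᵀ t
      reflᵀ     : ∀ {s} → s ≈ᵀ s
      symᵀ      : ∀ {s t} → s ≈ᵀ t → t ≈ᵀ s
      transᵀ    : ∀ {s t u} → s ≈ᵀ t → t ≈ᵀ u → s ≈ᵀ u
      ⊕-cong    : ∀ {s s′ t t′} → s ≈ᵀ s′ → t ≈ᵀ t′ → s ⊕ t ≈ᵀ s′ ⊕ t′
      ⊕-assoc   : ∀ s t u → (s ⊕ t) ⊕ u ≈ᵀ s ⊕ (t ⊕ u)
      ⊕-comm    : ∀ s t → s ⊕ t ≈ᵀ t ⊕ s
      ⊕-idˡ     : ∀ s → 𝟎 ⊕ s ≈ᵀ s
      ⊛-cong    : ∀ {k l s t} → k R.≈ l → s ≈ᵀ t → k ⊛ s ≈ᵀ l ⊛ t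
      ⊛-zeroˡ   : ∀ s → R.0# ⊛ s ≈ᵀ 𝟎
      ⊛-zeroʳ   : ∀ k → k ⊛ 𝟎 ≈ᵀ 𝟎
      ⊛-distribʳ : ∀ s k l → (k R.+ l) ⊛ s ≈ᵀ k ⊛ s ⊕ l ⊛ s
      ⊛-distribˡ : ∀ k s t → k ⊛ (s ⊕ t) ≈ᵀ k ⊛ s ⊕ k ⊛ t
      ⊛-idˡ     : ∀ s → R.1# ⊛ s ≈ᵀ s
      ⊛-assoc   : ∀ k l s → (k R.* l) ⊛ s ≈ᵀ k ⊛ (l ⊛ s)

    Presented : LeftModule R.ring (r ⊔ x) (r ⊔ ℓr ⊔ x ⊔ e)
    Presented = record
      { Carrierᴹ = Term X
      ; _≈ᴹ_ = _≈ᵀ_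
      ; _+ᴹ_ = _⊕_
      ; _*ₗ_ = _⊛_
      ; 0ᴹ = 𝟎
      ; -ᴹ_ = -ᵀ_
      ; isLeftModule = record
        { isLeftSemimodule = record
          { +ᴹ-isCommutativeMonoid = record
            { isMonoid = record
              { isSemigroup = record
                { isMagma = record
                  { isEquivalence = record { refl = reflᵀ ; sym = symᵀ ; trans = transᵀ }
                  ; ∙-cong = ⊕-cong
                  }
                ; assoc = ⊕-assoc
                }
              ; identity = ⊕-idˡ , λ s → transᵀ (⊕-comm s 𝟎) (⊕-idˡ s)
              }
            ; comm = ⊕-comm
            }
          ; isPreleftSemimodule = record
            { *ₗ-cong = ⊛-cong
            ; *ₗ-zeroˡ = ⊛-zeroˡ
            ; *ₗ-distribʳ = ⊛-distribʳ
            ; *ₗ-identityˡ = ⊛-idˡ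
            ; *ₗ-assoc = ⊛-assoc
            ; *ₗ-zeroʳ = ⊛-zeroʳ
            ; *ₗ-distribˡ = ⊛-distribˡ
            }
          }
        ; -ᴹ‿cong = ⊛-cong R.refl
        ; -ᴹ‿inverse = inverseˡ , λ s → transᵀ (⊕-comm s (-ᵀ s)) (inverseˡ s)
        }
      }
      where
      -ᵀ_ : Term X → Term X
      -ᵀ s = (R.- R.1#) ⊛ s

      inverseˡ : ∀ s → -ᵀ s ⊕ s ≈ᵀ 𝟎
      inverseˡ s = transᵀ (⊕-cong reflᵀ (symᵀ (⊛-idˡ s)))
        (transᵀ (symᵀ (⊛-distribʳ s (R.- R.1#) R.1#))
        (transᵀ (⊛-cong (R.-‿inverseˡ R.1#) reflᵀ) (⊛-zeroˡ s)))

  module _ (N : LeftModule R.ring n ℓn) where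
    private module N = LeftModule N

    eval : {X : Set x} → (X → N.Carrierᴹ) → Term X → N.Carrierᴹ
    eval f (gen x) = f x
    eval f 𝟎       = N.0ᴹ
    eval f (s ⊕ t) = eval f s N.+ᴹ eval f t
    eval f (k ⊛ s) = k N.*ₗ eval f s

    module _ {X : Set x} (E : Rel (Term X) e) where

      lift : (f : X → N.Carrierᴹ) → (∀ {s t} → E s t → eval f s N.≈ᴹ eval f t) →
             LinearMap (Presented E) N
      lift f f-resp = mkLinearMap (Presented E) N (eval f) eval-cong
                                  (λ _ _ → N.≈ᴹ-refl) (λ _ _ → N.≈ᴹ-refl)
        where
        eval-cong : ∀ {s t} → _≈ᵀ_ E s t → eval f s N.≈ᴹ eval f t
        eval-cong (rel st)           = f-resp st
        eval-cong reflᵀ              = N.≈ᴹ-refl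
        eval-cong (symᵀ p)           = N.≈ᴹ-sym (eval-cong p)
        eval-cong (transᵀ p q)       = N.≈ᴹ-trans (eval-cong p) (eval-cong q)
        eval-cong (⊕-cong p q)       = N.+ᴹ-cong (eval-cong p) (eval-cong q)
        eval-cong (⊕-assoc s t u)    = N.+ᴹ-assoc _ _ _
        eval-cong (⊕-comm s t)       = N.+ᴹ-comm _ _
        eval-cong (⊕-idˡ s)          = N.+ᴹ-identityˡ _
        eval-cong (⊛-cong k p)       = N.*ₗ-cong k (eval-cong p)
        eval-cong (⊛-zeroˡ s)        = N.*ₗ-zeroˡ _
        eval-cong (⊛-zeroʳ k)        = N.*ₗ-zeroʳ _
        eval-cong (⊛-distribʳ s k l) = N.*ₗ-distribʳ _ _ _
        eval-cong (⊛-distribˡ k s t) = N.*ₗ-distribˡ _ _ _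
        eval-cong (⊛-idˡ s)          = N.*ₗ-identityˡ _
        eval-cong (⊛-assoc k l s)    = N.*ₗ-assoc _ _ _

      ext : (f g : LinearMap (Presented E) N) →
            (∀ x → f ⟨$⟩ gen x N.≈ᴹ g ⟨$⟩ gen x) → ∀ t → f ⟨$⟩ t N.≈ᴹ g ⟨$⟩ t
      ext f g f≈g (gen x) = f≈g x
      ext f g f≈g 𝟎 = N.≈ᴹ-trans (LinearMap.0ᴹ-homo f) (N.≈ᴹ-sym (LinearMap.0ᴹ-homo g))
      ext f g f≈g (s ⊕ t) = N.≈ᴹ-trans (LinearMap.+ᴹ-homo f s t)
        (N.≈ᴹ-trans (N.+ᴹ-cong (ext f g f≈g s) (ext f g f≈g t))
                    (N.≈ᴹ-sym (LinearMap.+ᴹ-homo g s t)))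
      ext f g f≈g (k ⊛ s) = N.≈ᴹ-trans (LinearMap.*ₗ-homo f k s)
        (N.≈ᴹ-trans (N.*ₗ-congˡ (ext f g f≈g s)) (N.≈ᴹ-sym (LinearMap.*ₗ-homo g k s)))

  NoRelations : {X : Set x} → Rel (Term X) Level.zero
  NoRelations _ _ = ⊥

  Free : Set x → LeftModule R.ring (r ⊔ x) (r ⊔ ℓr ⊔ x)
  Free X = Presented {X = X} NoRelations

  module _ (M : LeftModule R.ring m ℓm) (N : LeftModule R.ring n ℓn) where
    private
      module M = LeftModule M
      module N = LeftModule N

    data Bilinear : Rel (Term (M.Carrierᴹ × N.Carrierᴹ)) (r ⊔ m ⊔ ℓm ⊔ n ⊔ ℓn) where
      cong-⊗ : ∀ {x x′ y y′} → x M.≈ᴹ x′ → y N.≈ᴹ y′ →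
               Bilinear (gen (x , y)) (gen (x′ , y′))
      +-⊗    : ∀ x x′ y →
               Bilinear (gen (x M.+ᴹ x′ , y)) (gen (x , y) ⊕ gen (x′ , y))
      ⊗-+    : ∀ x y y′ →
               Bilinear (gen (x , y N.+ᴹ y′)) (gen (x , y) ⊕ gen (x , y′))
      *-⊗    : ∀ k x y → Bilinear (gen (k M.*ₗ x , y)) (k ⊛ gen (x , y))
      ⊗-*    : ∀ k x y → Bilinear (gen (x , k N.*ₗ y)) (k ⊛ gen (x , y))

    _⊗_ : LeftModule R.ring (r ⊔ m ⊔ n) (r ⊔ ℓr ⊔ m ⊔ ℓm ⊔ n ⊔ ℓn)
    _⊗_ = Presented Bilinear

    _⊠_ : Functional M → Functional N → Functional _⊗_
    φ ⊠ ψ = lift TensorUnit.leftModule Bilinear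
      (λ (x , y) → φ ⟨$⟩ x R.* ψ ⟨$⟩ y)
      λ { (cong-⊗ p q) → R.*-cong (φ.⟦⟧-cong p) (ψ.⟦⟧-cong q)
        ; (+-⊗ x x′ y) → R.trans (R.*-congʳ (φ.+ᴹ-homo x x′)) (R.distribʳ _ _ _)
        ; (⊗-+ x y y′) → R.trans (R.*-congˡ (ψ.+ᴹ-homo y y′)) (R.distribˡ _ _ _)
        ; (*-⊗ k x y)  → R.trans (R.*-congʳ (φ.*ₗ-homo k x)) (R.*-assoc _ _ _)
        ; (⊗-* k x y)  → R.trans (R.*-congˡ (ψ.*ₗ-homo k y))
            (R.trans (R.sym (R.*-assoc _ _ _))
            (R.trans (R.*-congʳ (R.*-comm _ _)) (R.*-assoc _ _ _)))
        }
      where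
      module φ = LinearMap φ
      module ψ = LinearMap ψ

  module _ (M : LeftModule R.ring m ℓm) (Δ : LinearMap M (M ⊗ M)) where
    private module M = LeftModule M

    -- The span below is the image of P ⊗ P in M ⊗ M.
    record IsSubcoalgebra (P : Pred M.Carrierᴹ p) : Set (r ⊔ ℓr ⊔ m ⊔ ℓm ⊔ p) where
      field
        isSubmodule : IsSubmodule M P
        Δ-closed    : ∀ {x} → P x →
                      Span (M ⊗ M) {I = Σ M.Carrierᴹ P × Σ M.Carrierᴹ P}
                           (λ ((y , _) , (z , _)) → gen (y , z)) (Δ ⟨$⟩ x)

module PQSym {r ℓr} (R : CommutativeRing r ℓr) where

  private module R = CommutativeRing R

  open Modules R public

  PQSym² : LeftModule R.ring r (r ⊔ ℓr)
  PQSym² = Free ColoredPF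

  private module P = LeftModule PQSym²

  G : ColoredPF → P.Carrierᴹ
  G = gen

  Δ : LinearMap PQSym² (PQSym² ⊗ PQSym²)
  Δ = lift (PQSym² ⊗ PQSym²) NoRelations
    (λ c → sumᴹ (PQSym² ⊗ PQSym²) (λ (p , q) → gen (G p , G q)) (factorisations c))
    λ ()

  -- A functional on PQSym² lies in the graded dual when it vanishes on all but
  -- finitely many homogeneous components.
  record GradedFunctional : Set (r ⊔ ℓr) where
    constructor mkGraded
    field
      functional : Functional PQSym²
      vanishes   : ∃ λ N → ∀ p → N ≤ size p → functional ⟨$⟩ G p R.≈ R.0#

  open GradedFunctional public using (functional)

  infix 4 _≈*_

  _≈*_ : Rel GradedFunctional (r ⊔ ℓr)
  φ ≈* ψ = ∀ x → functional φ ⟨$⟩ x R.≈ functional ψ ⟨$⟩ x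

  GradedDual : LeftModule R.ring (r ⊔ ℓr) (r ⊔ ℓr)
  GradedDual = record
    { Carrierᴹ = GradedFunctional
    ; _≈ᴹ_ = _≈*_
    ; _+ᴹ_ = _+*_
    ; _*ₗ_ = _·*_
    ; 0ᴹ = 0*
    ; -ᴹ_ = -*_
    ; isLeftModule = record
      { isLeftSemimodule = record
        { +ᴹ-isCommutativeMonoid = record
          { isMonoid = record
            { isSemigroup = record
              { isMagma = record
                { isEquivalence = record
                  { refl = λ _ → R.refl
                  ; sym = λ p x → R.sym (p x)
                  ; trans = λ p q x → R.trans (p x) (q x)
                  }
                ; ∙-cong = λ p q x → R.+-cong (p x) (q x)
                }
              ; assoc = λ _ _ _ _ → R.+-assoc _ _ _
              }
            ; identity = (λ _ _ → R.+-identityˡ _) , λ _ _ → R.+-identityʳ _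
            }
          ; comm = λ _ _ _ → R.+-comm _ _
          }
        ; isPreleftSemimodule = record
          { *ₗ-cong = λ k p x → R.*-cong k (p x)
          ; *ₗ-zeroˡ = λ _ _ → R.zeroˡ _
          ; *ₗ-distribʳ = λ _ _ _ _ → R.distribʳ _ _ _
          ; *ₗ-identityˡ = λ _ _ → R.*-identityˡ _
          ; *ₗ-assoc = λ _ _ _ _ → R.*-assoc _ _ _
          ; *ₗ-zeroʳ = λ _ _ → R.zeroʳ _
          ; *ₗ-distribˡ = λ _ _ _ _ → R.distribˡ _ _ _
          }
        }
      ; -ᴹ‿cong = λ p x → R.-‿cong (p x)
      ; -ᴹ‿inverse = (λ _ _ → R.-‿inverseˡ _) , λ _ _ → R.-‿inverseʳ _
      }
    }
    where
    open CommutativeSemigroupProperties R.+-commutativeSemigroup using (interchange)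
    open RingProperties R.ring using (-0#≈0#; -‿+-comm; -‿distribʳ-*)

    pointwise = mkLinearMap PQSym² TensorUnit.leftModule

    _+*_ : GradedFunctional → GradedFunctional → GradedFunctional
    mkGraded φ (N , φ-N) +* mkGraded ψ (M , ψ-M) = record
      { functional = pointwise (λ x → φ ⟨$⟩ x R.+ ψ ⟨$⟩ x)
          (λ p → R.+-cong (LinearMap.⟦⟧-cong φ p) (LinearMap.⟦⟧-cong ψ p))
          (λ x y → R.trans (R.+-cong (LinearMap.+ᴹ-homo φ x y) (LinearMap.+ᴹ-homo ψ x y))
                           (interchange _ _ _ _))
          (λ k x → R.trans (R.+-cong (LinearMap.*ₗ-homo φ k x) (LinearMap.*ₗ-homo ψ k x))
                           (R.sym (R.distribˡ _ _ _)))
      ; vanishes = N + M , λ p N+M≤ → R.trans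
          (R.+-cong (φ-N p (≤-trans (m≤m+n N M) N+M≤)) (ψ-M p (≤-trans (m≤n+m M N) N+M≤)))
          (R.+-identityˡ _)
      }

    _·*_ : R.Carrier → GradedFunctional → GradedFunctional
    k ·* mkGraded φ (N , φ-N) = record
      { functional = pointwise (λ x → k R.* φ ⟨$⟩ x)
          (λ p → R.*-congˡ (LinearMap.⟦⟧-cong φ p))
          (λ x y → R.trans (R.*-congˡ (LinearMap.+ᴹ-homo φ x y)) (R.distribˡ _ _ _))
          (λ l x → R.trans (R.*-congˡ (LinearMap.*ₗ-homo φ l x)) (R.trans
            (R.sym (R.*-assoc _ _ _)) (R.trans (R.*-congʳ (R.*-comm _ _)) (R.*-assoc _ _ _))))
      ; vanishes = N , λ p N≤ → R.trans (R.*-congˡ (φ-N p N≤)) (R.zeroʳ _)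
      }

    0* : GradedFunctional
    0* = record
      { functional = pointwise (λ _ → R.0#) (λ _ → R.refl)
          (λ _ _ → R.sym (R.+-identityˡ _)) (λ _ _ → R.sym (R.zeroʳ _))
      ; vanishes = 0 , λ _ _ → R.refl
      }

    -*_ : GradedFunctional → GradedFunctional
    -* mkGraded φ (N , φ-N) = record
      { functional = pointwise (λ x → R.- (φ ⟨$⟩ x))
          (λ p → R.-‿cong (LinearMap.⟦⟧-cong φ p))
          (λ x y → R.trans (R.-‿cong (LinearMap.+ᴹ-homo φ x y)) (R.sym (-‿+-comm _ _)))
          (λ k x → R.trans (R.-‿cong (LinearMap.*ₗ-homo φ k x)) (-‿distribʳ-* _ _))
      ; vanishes = N , λ p N≤ → R.trans (R.-‿cong (φ-N p N≤)) -0#≈0#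
      }

  private
    K = TensorUnit.leftModule {R = R.ring}

    sum-zero : ∀ {a} {A : Set a} (f : A → R.Carrier) xs →
               (∀ {x} → x ∈ xs → f x R.≈ R.0#) → sumᴹ K f xs R.≈ R.0#
    sum-zero f []       f≈0 = R.refl
    sum-zero f (x ∷ xs) f≈0 = R.trans
      (R.+-cong (f≈0 (here refl)) (sum-zero f xs (f≈0 ∘ there))) (R.+-identityˡ _)

    sum-single : ∀ {a} {A : Set a} (f : A → R.Carrier) {xs y} → Unique xs → y ∈ xs →
                 (∀ {x} → x ≢ y → f x R.≈ R.0#) → sumᴹ K f xs R.≈ f y
    sum-single f {x ∷ xs} (x∉ ∷ u) (here refl) f≈0 = R.trans
      (R.+-congˡ (sum-zero f xs (λ z∈ → f≈0 (All.lookup x∉ z∈ ∘ sym)))) (R.+-identityʳ _)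
    sum-single f {x ∷ xs} (x∉ ∷ u) (there y∈) f≈0 = R.trans
      (R.+-cong (f≈0 (All.lookup x∉ y∈)) (sum-single f u y∈ f≈0)) (R.+-identityˡ _)

  ⊠-Δ : ∀ φ ψ c → (_⊠_ PQSym² PQSym² φ ψ ∘ₗ Δ) ⟨$⟩ G c
        R.≈ sumᴹ K (λ (p , q) → φ ⟨$⟩ G p R.* ψ ⟨$⟩ G q) (factorisations c)
  ⊠-Δ φ ψ c = sumᴹ-homo (PQSym² ⊗ PQSym²) K (_⊠_ PQSym² PQSym² φ ψ) _ (factorisations c)

  -- The transpose of Δ, whose values on the dual basis are given by F-∗ below.
  infixl 7 _∗_

  _∗_ : GradedFunctional → GradedFunctional → GradedFunctional
  mkGraded φ (N , φ-N) ∗ mkGraded ψ (M , ψ-M) = record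
    { functional = _⊠_ PQSym² PQSym² φ ψ ∘ₗ Δ
    ; vanishes = N + M , λ c N+M≤ → R.trans (⊠-Δ φ ψ c)
        (sum-zero _ (factorisations c) λ {(p , q)} pq∈ → summand p q
          (subst (N + M ≤_) (⋒-size p q (∈-factorisations⁻ pq∈)) N+M≤))
    }
    where
    summand : ∀ p q → N + M ≤ size p + size q → φ ⟨$⟩ G p R.* ψ ⟨$⟩ G q R.≈ R.0#
    summand p q N+M≤ with N ≤? size p | M ≤? size q
    ... | yes N≤ | _      = R.trans (R.*-congʳ (φ-N p N≤)) (R.zeroˡ _)
    ... | no _   | yes M≤ = R.trans (R.*-congˡ (ψ-M q M≤)) (R.zeroʳ _)
    ... | no N≰  | no M≰  = contradiction N+M≤ (<⇒≱ (+-mono-< (≰⇒> N≰) (≰⇒> M≰)))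

  δ : ColoredPF → ColoredPF → R.Carrier
  δ p q with p ≟ q
  ... | yes _ = R.1#
  ... | no _  = R.0#

  private
    δ-refl : ∀ p → δ p p R.≈ R.1#
    δ-refl p with p ≟ p
    ... | yes _  = R.refl
    ... | no p≢p = contradiction refl p≢p

    δ-≢ : ∀ {p q} → p ≢ q → δ p q R.≈ R.0#
    δ-≢ {p} {q} p≢q with p ≟ q
    ... | yes p≡q = contradiction p≡q p≢q
    ... | no _    = R.refl

    δδ-≢ : ∀ p q p′ q′ → (p′ , q′) ≢ (p , q) → δ p p′ R.* δ q q′ R.≈ R.0#
    δδ-≢ p q p′ q′ ≢pq with p ≟ p′
    ... | no _     = R.zeroˡ _
    ... | yes refl = R.trans
      (R.*-congˡ (δ-≢ {q} {q′} (λ q≡ → ≢pq (cong (p ,_) (sym q≡))))) (R.zeroʳ _)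

  -- The basis dual to G.
  F : ColoredPF → GradedFunctional
  F p = record
    { functional = lift K NoRelations (δ p) λ ()
    ; vanishes   = suc (size p) , λ q p<q → δ-≢ {p} {q} (λ p≡q → ℕ.<⇒≢ p<q (cong size p≡q))
    }

  F-∗ : ∀ p q → F p ∗ F q ≈* sumᴹ GradedDual F (p ⋒ q)
  F-∗ p q = ext K NoRelations (functional (F p ∗ F q))
                              (functional (sumᴹ GradedDual F (p ⋒ q)))
    λ c → R.trans (⊠-Δ (functional (F p)) (functional (F q)) c)
                  (R.trans (coefficients c (c ∈? p ⋒ q)) (R.sym (functional-sum (p ⋒ q) c)))
    where
    functional-sum : ∀ xs c → functional (sumᴹ GradedDual F xs) ⟨$⟩ G c
                              R.≈ sumᴹ K (λ s → δ s c) xs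
    functional-sum []       c = R.refl
    functional-sum (x ∷ xs) c = R.+-congˡ (functional-sum xs c)

    coefficients : ∀ c → Dec (c ∈ p ⋒ q) →
                   sumᴹ K (λ (p′ , q′) → δ p p′ R.* δ q q′) (factorisations c)
                   R.≈ sumᴹ K (λ s → δ s c) (p ⋒ q)
    coefficients c (yes c∈) = R.trans
      (sum-single (λ (p′ , q′) → δ p p′ R.* δ q q′) (factorisations-unique c)
        (∈-factorisations⁺ {c} {p} {q} c∈) (λ {(p′ , q′)} → δδ-≢ p q p′ q′))
      (R.trans (R.*-cong (δ-refl p) (δ-refl q))
      (R.trans (R.*-identityˡ _)
      (R.sym (R.trans
        (sum-single (λ s → δ s c) (⋒-unique p q) c∈ (λ {s} → δ-≢ {s} {c}))
        (δ-refl c)))))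
    coefficients c (no c∉) = R.trans
      (sum-zero (λ (p′ , q′) → δ p p′ R.* δ q q′) (factorisations c)
        (λ {(p′ , q′)} pq∈ → δδ-≢ p q p′ q′ (λ { refl →
          c∉ (∈-factorisations⁻ {c} {p} {q} pq∈) })))
      (R.sym (sum-zero (λ s → δ s c) (p ⋒ q) (λ {s} s∈ → δ-≢ {s} {c} (λ { refl →
        c∉ s∈ }))))

  -- The counit of PQSym², which is the unit for the transpose of Δ.
  1* : GradedFunctional
  1* = F ∅

  Level2PF : Set
  Level2PF = Σ ColoredPF Level2

  Level2Span-F : Pred GradedFunctional (r ⊔ ℓr)
  Level2Span-F = Span GradedDual {I = Level2PF} (λ (p , _) → F p)

  Level2Span-G : Pred P.Carrierᴹ (r ⊔ ℓr)
  Level2Span-G = Span PQSym² {I = Level2PF} (λ (p , _) → G p)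

{-# OPTIONS --safe #-}

-- Shifting the letters of the second factor above those of the first makes the two
-- alphabets disjoint.  Equal letters of a word of u ⋒ v then come from the same factor,
-- in their original order, and a value is a match of the word exactly when it is the
-- (shifted) match of the factor it comes from.  Hence the word is level 2 if and only if
-- both factors are: "if" makes the span of the F closed under the product, and "only if"
-- makes the span of the G closed under the coproduct.

module Submission where

open import Defs
open import Algebra.Bundles using (CommutativeMonoid; CommutativeRing)
open import Algebra.Module.Bundles using (LeftModule)
import Algebra.Module.Construct.TensorUnit as TensorUnit
import Algebra.Properties.CommutativeSemigroup as CommutativeSemigroupProperties
import Data.Fin.Base as Fin
open import Data.Fin.Patterns using (0F; 1F)
open import Data.List.Base
  using (List; []; _∷_; _++_; map; length; lookup; filter)
open import Data.List.Membership.Propositional using (_∈_)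
open import Data.List.Membership.Propositional.Properties
  using (∈-++⁺ˡ; ∈-++⁺ʳ; ∈-++⁻; ∈-map⁺; ∈-map⁻; ∈-lookup)
open import Data.List.Properties
  using (filter-++; filter-all; filter-none; length-++; length-map; map-++; map-∘;
         tabulate-lookup)
open import Data.List.Relation.Binary.Permutation.Propositional
  using (_↭_; ↭-sym; ↭-trans; ↭-reflexive)
open import Data.List.Relation.Binary.Permutation.Propositional.Properties
  using (↭-length; filter-↭; map⁺; All-resp-↭; ∈-resp-↭)
open import Data.List.Relation.Unary.All as All using (All; []; _∷_)
import Data.List.Relation.Unary.All.Properties as All
open import Data.List.Relation.Unary.AllPairs as AllPairs using (AllPairs; []; _∷_)
import Data.List.Relation.Unary.AllPairs.Properties as AllPairs
open import Data.List.Relation.Unary.Any using (here; there; index)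
open import Data.List.Relation.Unary.Any.Properties using (lookup-index)
open import Data.Nat.Base using (ℕ; suc; _+_; _≤_; _<_; s≤s)
open import Data.Nat.Properties
  using (_<?_; _≤?_; ≤-trans; ≤-reflexive; ≤-<-trans; <⇒≤; <⇒≱; +-identityʳ; +-suc;
         +-cancelˡ-≡; +-cancelˡ-≤; +-cancelˡ-<; +-monoʳ-≤; +-monoʳ-<; m<m+n; m≤m+n)
open import Data.Product using (∃; _×_; _,_; proj₁; proj₂)
open import Data.Sum.Base using (_⊎_; inj₁; inj₂)
open import Function.Base using (_∘_)
open import Function.Bundles using (_⇔_; mk⇔; Equivalence)
import Level
open import Relation.Binary.Core using (Rel)
open import Relation.Binary.PropositionalEquality
  using (_≡_; refl; sym; trans; cong; cong₂; subst)
open import Relation.Nullary.Decidable using (yes; no)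
open import Relation.Nullary.Negation using (¬_; contradiction)
open import Relation.Unary using (Pred; Decidable)

-- Pairwise relations along a shuffle.

module _ {a ℓ} {A : Set a} {R : Rel A ℓ} where

  AllPairs-lookup : ∀ {xs} → AllPairs R xs → ∀ {i j} → i Fin.< j →
                    R (lookup xs i) (lookup xs j)
  AllPairs-lookup (px ∷ _)  {Fin.zero}  {Fin.suc j} _         = All.lookup px (∈-lookup j)
  AllPairs-lookup (_ ∷ pxs) {Fin.suc i} {Fin.suc j} (s≤s i<j) = AllPairs-lookup pxs i<j

  -- A shuffle keeps the order inside each factor, so only pairs taken across the factors are new.
  -- These can occur in either order, which is why `R` is asked in both directions.
  shuffle-AllPairs⁺ : ∀ u v → (∀ {x y} → x ∈ u → y ∈ v → R x y × R y x) →
                      AllPairs R u → AllPairs R v →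
                      ∀ {w} → w ∈ shuffle u v → AllPairs R w
  shuffle-AllPairs⁺ []      v       _ _  pv (here refl) = pv
  shuffle-AllPairs⁺ (_ ∷ _) []      _ pu _  (here refl) = pu
  shuffle-AllPairs⁺ (x ∷ u) (y ∷ v) r (px ∷ pu) (py ∷ pv) w∈
    with ∈-++⁻ (map (x ∷_) (shuffle u (y ∷ v))) w∈
  ... | inj₁ w∈ˡ with ∈-map⁻ (x ∷_) w∈ˡ
  ...   | _ , w′∈ , refl =
    -- What follows `x` is a permutation of `u ++ y ∷ v`, and `All` does not see the order.
    All-resp-↭ (↭-sym (shuffle-↭ u (y ∷ v) w′∈))
      (All.++⁺ px (All.tabulate (proj₁ ∘ r (here refl))))
    ∷ shuffle-AllPairs⁺ u (y ∷ v) (r ∘ there) pu (py ∷ pv) w′∈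
  shuffle-AllPairs⁺ (x ∷ u) (y ∷ v) r (px ∷ pu) (py ∷ pv) w∈
      | inj₂ w∈ʳ with ∈-map⁻ (y ∷_) w∈ʳ
  ...   | _ , w′∈ , refl =
    All-resp-↭ (↭-sym (shuffle-↭ (x ∷ u) v w′∈))
      -- Here `y` precedes all of `x ∷ u`, so the reversed relation is the one needed.
      (All.++⁺ (All.tabulate (λ z∈ → proj₂ (r z∈ (here refl)))) py)
    ∷ shuffle-AllPairs⁺ (x ∷ u) v (λ z∈ → r z∈ ∘ there) (px ∷ pu) pv w′∈

  shuffle-AllPairs⁻ : ∀ u v {w} → w ∈ shuffle u v → AllPairs R w →
                      AllPairs R u × AllPairs R v
  shuffle-AllPairs⁻ []      v       (here refl) pw = [] , pw
  shuffle-AllPairs⁻ (_ ∷ _) []      (here refl) pw = pw , []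
  shuffle-AllPairs⁻ (x ∷ u) (y ∷ v) w∈ pw
    with ∈-++⁻ (map (x ∷_) (shuffle u (y ∷ v))) w∈
  ... | inj₁ w∈ˡ with ∈-map⁻ (x ∷_) w∈ˡ | pw
  ...   | _ , w′∈ , refl | px ∷ pw′ with shuffle-AllPairs⁻ u (y ∷ v) w′∈ pw′
  ...     | pu , pv =
    All.++⁻ˡ u (All-resp-↭ (shuffle-↭ u (y ∷ v) w′∈) px) ∷ pu , pv
  shuffle-AllPairs⁻ (x ∷ u) (y ∷ v) w∈ pw
      | inj₂ w∈ʳ with ∈-map⁻ (y ∷_) w∈ʳ | pw
  ...   | _ , w′∈ , refl | py ∷ pw′ with shuffle-AllPairs⁻ (x ∷ u) v w′∈ pw′
  ...     | pu , pv =
    pu , All.++⁻ʳ (x ∷ u) (All-resp-↭ (shuffle-↭ (x ∷ u) v w′∈) py) ∷ pv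

-- Matches of a shifted concatenation, by counting letters.

length-filter-map : ∀ {p q} {P : Pred ℕ p} {Q : Pred ℕ q}
                    (P? : Decidable P) (Q? : Decidable Q) (f : ℕ → ℕ) xs →
                    All (λ x → P (f x) ⇔ Q x) xs →
                    length (filter P? (map f xs)) ≡ length (filter Q? xs)
length-filter-map P? Q? f []       []         = refl
length-filter-map P? Q? f (x ∷ xs) (eq ∷ eqs) with P? (f x) | Q? x
... | yes _  | yes _  = cong suc (length-filter-map P? Q? f xs eqs)
... | no _   | no _   = length-filter-map P? Q? f xs eqs
... | yes pf | no ¬q  = contradiction (Equivalence.to eq pf) ¬q
... | no ¬pf | yes q  = contradiction (Equivalence.from eq q) ¬pf

module ShiftedConcatenation {a b c : List ℕ} (c↭ : c ↭ a ++ map (length a +_) b)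
  (a≤ : All (_≤ length a) a) (b≥ : All (1 ≤_) b) where

  private
    n = length a

    count : ∀ {p} {P : Pred ℕ p} (P? : Decidable P) →
            length (filter P? c) ≡ length (filter P? a) + length (filter P? (map (n +_) b))
    count P? = trans (↭-length (filter-↭ P? c↭))
      (trans (cong length (filter-++ P? a _)) (length-++ (filter P? a)))

    countˡ : ∀ {p} {P : Pred ℕ p} (P? : Decidable P) → (∀ {y} → n < y → ¬ P y) →
             length (filter P? c) ≡ length (filter P? a)
    countˡ P? ¬P = trans (count P?) (trans
      (cong (λ ys → length (filter P? a) + length ys)
        (filter-none P? (All.map⁺ (All.map (λ 1≤y → ¬P (m<m+n n 1≤y)) b≥))))
      (+-identityʳ _))

    countʳ : ∀ {p q} {P : Pred ℕ p} {Q : Pred ℕ q} (P? : Decidable P) (Q? : Decidable Q) →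
             (∀ {x} → x ≤ n → P x) → (∀ y → P (n + y) ⇔ Q y) →
             length (filter P? c) ≡ n + length (filter Q? b)
    countʳ P? Q? Pa eq = trans (count P?) (cong₂ _+_
      (cong length (filter-all P? (All.map Pa a≤)))
      (length-filter-map P? Q? (n +_) b (All.universal eq b)))

  -- The shifted letters all exceed `n`, hence `x`, so neither of the two counts in `MatchAt` sees
  -- them.
  matchˡ : ∀ {x} → x ≤ n → MatchAt c x ⇔ MatchAt a x
  matchˡ {x} x≤n
    rewrite countˡ (_<? x) (λ n<y y<x → <⇒≱ n<y (≤-trans (<⇒≤ y<x) x≤n))
          | countˡ (_≤? x) (λ n<y y≤x → <⇒≱ n<y (≤-trans y≤x x≤n))
    = mk⇔ (λ m → m) (λ m → m)

  -- Every letter of `a` is at most `n`, so strictly below `n + x`. Both counts therefore grow by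
  -- exactly `n`, which cancels against the shift of the threshold.
  matchʳ : ∀ {x} → 1 ≤ x → MatchAt c (n + x) ⇔ MatchAt b x
  matchʳ {x} 1≤x
    rewrite countʳ (_<? n + x) (_<? x) (λ y≤n → ≤-<-trans y≤n (m<m+n n 1≤x))
              (λ y → mk⇔ (+-cancelˡ-< n y x) (+-monoʳ-< n))
          | countʳ (_≤? n + x) (_≤? x) (λ y≤n → ≤-trans y≤n (m≤m+n n x))
              (λ y → mk⇔ (+-cancelˡ-≤ n y x) (+-monoʳ-≤ n))
          -- Moves the `suc` of `MatchAt` to the right of `n`, so that `n` can be cancelled.
          | sym (+-suc n (length (filter (_<? x) b)))
    = mk⇔ (λ (eq , le) → +-cancelˡ-≡ n _ _ eq , +-cancelˡ-≤ n _ _ le)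
          (λ (eq , le) → cong (n +_) eq , +-monoʳ-≤ n le)

-- The level 2 conditions without positions.

ColorLeft : Rel Biletter Level.zero
ColorLeft (x , s) (y , t) = x ≡ y → t ≡ 1F → s ≡ 1F

-- Conditions (i) and (iii) become statements about membership, which transfer along permutations.
-- Condition (ii) becomes an `AllPairs`, which follows the recursion of `shuffle`; in `ColorLeft`
-- the first biletter is the one further left.
record LevelTwo (w : List Biletter) : Set where
  field
    match : ∀ {x} → (x , 1F) ∈ w → MatchAt (letters w) x
    left  : AllPairs ColorLeft w
    once  : ∀ {x s} → (x , s) ∈ w → (x , 0F) ∈ w

Level2⇔LevelTwo : ∀ {p} → Level2 p ⇔ LevelTwo (word p)
Level2⇔LevelTwo {p} = mk⇔ to from
  where
  w = word p

  to : Level2 p → LevelTwo w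
  to l = record
    { match = λ x∈ → subst (MatchAt (letters w)) (sym (cong proj₁ (lookup-index x∈)))
        (color1-match (index x∈) (sym (cong proj₂ (lookup-index x∈))))
    ; left  = subst (AllPairs ColorLeft) (tabulate-lookup w)
        (AllPairs.tabulate⁺-< λ {i} {j} i<j eq cj → color1-left j i cj i<j eq)
    ; once  = λ x∈ → subst (λ y → (y , 0F) ∈ w) (sym (cong proj₁ (lookup-index x∈)))
        (color0-once (index x∈))
    }
    where open Level2 l

  from : LevelTwo w → Level2 p
  from l = record
    { color1-match = λ i ci → match (subst (λ t → (proj₁ (lookup w i) , t) ∈ w) ci (∈-lookup i))
    ; color1-left  = λ i j ci j<i eq → AllPairs-lookup left j<i eq ci
    ; color0-once  = λ i → once (∈-lookup i)
    }
    where open LevelTwo l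

-- Level 2 words and the shifted shuffle.

module _ {u v w : List Biletter} (w∈ : w ∈ shiftedShuffle u v)
  (u-parking : IsParking (letters u)) (v-parking : IsParking (letters v)) where

  private
    k = length u

    length-u : length (letters u) ≡ k
    length-u = length-map proj₁ u

    w↭ : w ↭ u ++ v [ k ]
    w↭ = shuffle-↭ u (v [ k ]) w∈

    letters-w : letters w ↭ letters u ++ map (length (letters u) +_) (letters v)
    letters-w = ↭-trans (map⁺ proj₁ w↭) (↭-reflexive (trans (map-++ proj₁ u _)
      -- The two uses of `map-∘` meet because `proj₁ ∘ map₁ (k +_)` and `(k +_) ∘ proj₁` agree
      -- definitionally.
      (cong (letters u ++_) (trans (sym (map-∘ v))
        (trans (map-∘ v) (cong (λ m → map (m +_) (letters v)) (sym length-u)))))))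

    open ShiftedConcatenation letters-w
      (All.map proj₂ (proj₁ u-parking)) (All.map proj₁ (proj₁ v-parking))

    letter≤ : ∀ {x s} → (x , s) ∈ u → x ≤ length (letters u)
    letter≤ x∈ = proj₂ (All.lookup (proj₁ u-parking) (∈-map⁺ proj₁ x∈))

    letter≥ : ∀ {x s} → (x , s) ∈ v → 1 ≤ x
    letter≥ x∈ = proj₁ (All.lookup (proj₁ v-parking) (∈-map⁺ proj₁ x∈))

    match-u : ∀ {x s} → (x , s) ∈ u → MatchAt (letters w) x ⇔ MatchAt (letters u) x
    match-u x∈ = matchˡ (letter≤ x∈)

    match-v : ∀ {x s} → (x , s) ∈ v → MatchAt (letters w) (k + x) ⇔ MatchAt (letters v) x
    match-v {x} x∈ = subst (λ m → MatchAt (letters w) (m + x) ⇔ _) length-u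
      (matchʳ (letter≥ x∈))

    -- Parking bounds the letters of `u` by `k`, while those of `v` are at least 1 and so are
    -- shifted above `k`.
    shift≢ : ∀ {x y s t} → (x , s) ∈ u → (y , t) ∈ v → ¬ x ≡ k + y
    shift≢ x∈ y∈ eq = <⇒≱ (m<m+n k (letter≥ y∈))
      (≤-trans (≤-reflexive (sym eq)) (≤-trans (letter≤ x∈) (≤-reflexive length-u)))

    u⊆w : ∀ {b} → b ∈ u → b ∈ w
    u⊆w b∈ = ∈-resp-↭ (↭-sym w↭) (∈-++⁺ˡ b∈)

    v⊆w : ∀ {x s} → (x , s) ∈ v → (k + x , s) ∈ w
    v⊆w x∈ = ∈-resp-↭ (↭-sym w↭) (∈-++⁺ʳ u (∈-map⁺ _ x∈))

    w⊆ : ∀ {x s} → (x , s) ∈ w → (x , s) ∈ u ⊎ ∃ λ y → (y , s) ∈ v × x ≡ k + y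
    w⊆ x∈ with ∈-++⁻ u (∈-resp-↭ w↭ x∈)
    ... | inj₁ x∈u = inj₁ x∈u
    ... | inj₂ x∈v with ∈-map⁻ _ x∈v
    ...   | _ , y∈v , refl = inj₂ (_ , y∈v , refl)

  shiftedShuffle-levelTwo⁺ : LevelTwo u → LevelTwo v → LevelTwo w
  shiftedShuffle-levelTwo⁺ lu lv = record
    { match = match
    ; left  = shuffle-AllPairs⁺ u (v [ k ]) across U.left
        (AllPairs.map⁺ (AllPairs.map (λ f eq → f (+-cancelˡ-≡ k _ _ eq)) V.left)) w∈
    ; once  = once
    }
    where
    module U = LevelTwo lu
    module V = LevelTwo lv

    match : ∀ {x} → (x , 1F) ∈ w → MatchAt (letters w) x
    match x∈ with w⊆ x∈
    ... | inj₁ x∈u              = Equivalence.from (match-u x∈u) (U.match x∈u)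
    ... | inj₂ (_ , y∈v , refl) = Equivalence.from (match-v y∈v) (V.match y∈v)

    once : ∀ {x s} → (x , s) ∈ w → (x , 0F) ∈ w
    once x∈ with w⊆ x∈
    ... | inj₁ x∈u              = u⊆w (U.once x∈u)
    ... | inj₂ (_ , y∈v , refl) = v⊆w (V.once y∈v)

    -- Vacuous: `ColorLeft` only constrains equal letters, and the two alphabets are disjoint.
    across : ∀ {b b′} → b ∈ u → b′ ∈ v [ k ] → ColorLeft b b′ × ColorLeft b′ b
    across b∈ b′∈ with ∈-map⁻ _ b′∈
    ... | _ , y∈v , refl = (λ eq → contradiction eq (shift≢ b∈ y∈v))
                         , (λ eq → contradiction (sym eq) (shift≢ b∈ y∈v))

  shiftedShuffle-levelTwo⁻ : LevelTwo w → LevelTwo u × LevelTwo v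
  shiftedShuffle-levelTwo⁻ lw = record
    { match = λ x∈ → Equivalence.to (match-u x∈) (match (u⊆w x∈))
    ; left  = proj₁ lefts
    ; once  = onceᵘ
    } , record
    { match = λ x∈ → Equivalence.to (match-v x∈) (match (v⊆w x∈))
    ; left  = AllPairs.map (λ f eq → f (cong (k +_) eq)) (AllPairs.map⁻ (proj₂ lefts))
    ; once  = onceᵛ
    }
    where
    open LevelTwo lw

    lefts = shuffle-AllPairs⁻ u (v [ k ]) w∈ left

    onceᵘ : ∀ {x s} → (x , s) ∈ u → (x , 0F) ∈ u
    -- The copy of color 0 found in `w` could a priori come from either factor; `shift≢` rules out
    -- the wrong one, here and in `onceᵛ`.
    onceᵘ x∈ with w⊆ (once (u⊆w x∈))
    ... | inj₁ x∈u            = x∈u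
    ... | inj₂ (_ , y∈v , eq) = contradiction eq (shift≢ x∈ y∈v)

    onceᵛ : ∀ {x s} → (x , s) ∈ v → (x , 0F) ∈ v
    onceᵛ x∈ with w⊆ (once (v⊆w x∈))
    ... | inj₁ x∈u            = contradiction refl (shift≢ x∈u x∈)
    ... | inj₂ (_ , y∈v , eq) =
      subst (λ z → (z , 0F) ∈ v) (sym (+-cancelˡ-≡ k _ _ eq)) y∈v

⋒-level2⁺ : ∀ p q {c} → c ∈ p ⋒ q → Level2 p → Level2 q → Level2 c
⋒-level2⁺ p q c∈ lp lq = Equivalence.from Level2⇔LevelTwo
  (shiftedShuffle-levelTwo⁺ (∈-⋒⁻ p q c∈) (isParking p) (isParking q)
    (Equivalence.to Level2⇔LevelTwo lp) (Equivalence.to Level2⇔LevelTwo lq))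

⋒-level2⁻ : ∀ p q {c} → c ∈ p ⋒ q → Level2 c → Level2 p × Level2 q
⋒-level2⁻ p q c∈ lc =
  let lu , lv = shiftedShuffle-levelTwo⁻ (∈-⋒⁻ p q c∈) (isParking p) (isParking q)
                  (Equivalence.to Level2⇔LevelTwo lc)
  in Equivalence.from Level2⇔LevelTwo lu , Equivalence.from Level2⇔LevelTwo lv

-- There are no positions to check. This puts the unit `F ∅` in the span.
∅-level2 : Level2 ∅
∅-level2 = record
  { color1-match = λ ()
  ; color1-left  = λ ()
  ; color0-once  = λ ()
  }

-- Extension from basis elements to spans by linearity.

module _ {r ℓr} (R : CommutativeRing r ℓr) where

  open PQSym R
  private module R = CommutativeRing R

  module _ {m ℓm} (M : LeftModule R.ring m ℓm) where
    private module M = LeftModule M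

    span-isSubmodule : ∀ {i} {I : Set i} (v : I → M.Carrierᴹ) → IsSubmodule M (Span M v)
    span-isSubmodule v = record
      { resp = resp ; 0ᴹ-closed = zero ; +ᴹ-closed = add ; *ₗ-closed = smul }

    sumᴹ-span : ∀ {i} {I : Set i} (v : I → M.Carrierᴹ) {a} {A : Set a}
                (f : A → M.Carrierᴹ) xs → (∀ {x} → x ∈ xs → Span M v (f x)) →
                Span M v (sumᴹ M f xs)
    sumᴹ-span v f []       f∈ = zero
    sumᴹ-span v f (x ∷ xs) f∈ = add (f∈ (here refl)) (sumᴹ-span v f xs (f∈ ∘ there))

    -- eval is linear in the assignment of the generators, not only in the term.
    module _ {x} {X : Set x} where
      open CommutativeSemigroupProperties
        (CommutativeMonoid.commutativeSemigroup M.+ᴹ-commutativeMonoid) using (interchange)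

      eval-cong : ∀ {f g : X → M.Carrierᴹ} → (∀ x → f x M.≈ᴹ g x) →
                  ∀ t → eval M f t M.≈ᴹ eval M g t
      eval-cong f≈g (gen x) = f≈g x
      eval-cong f≈g 𝟎       = M.≈ᴹ-refl
      eval-cong f≈g (s ⊕ t) = M.+ᴹ-cong (eval-cong f≈g s) (eval-cong f≈g t)
      eval-cong f≈g (k ⊛ t) = M.*ₗ-congˡ (eval-cong f≈g t)

      eval-0ᴹ : ∀ (t : Term X) → eval M (λ _ → M.0ᴹ) t M.≈ᴹ M.0ᴹ
      eval-0ᴹ (gen x) = M.≈ᴹ-refl
      eval-0ᴹ 𝟎       = M.≈ᴹ-refl
      eval-0ᴹ (s ⊕ t) = M.≈ᴹ-trans (M.+ᴹ-cong (eval-0ᴹ s) (eval-0ᴹ t)) (M.+ᴹ-identityˡ _)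
      eval-0ᴹ (k ⊛ t) = M.≈ᴹ-trans (M.*ₗ-congˡ (eval-0ᴹ t)) (M.*ₗ-zeroʳ k)

      eval-+ᴹ : ∀ (f g : X → M.Carrierᴹ) t →
                eval M (λ x → f x M.+ᴹ g x) t M.≈ᴹ eval M f t M.+ᴹ eval M g t
      eval-+ᴹ f g (gen x) = M.≈ᴹ-refl
      eval-+ᴹ f g 𝟎       = M.≈ᴹ-sym (M.+ᴹ-identityˡ _)
      eval-+ᴹ f g (s ⊕ t) =
        M.≈ᴹ-trans (M.+ᴹ-cong (eval-+ᴹ f g s) (eval-+ᴹ f g t)) (interchange _ _ _ _)
      eval-+ᴹ f g (k ⊛ t) = M.≈ᴹ-trans (M.*ₗ-congˡ (eval-+ᴹ f g t)) (M.*ₗ-distribˡ k _ _)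

      eval-*ₗ : ∀ k (f : X → M.Carrierᴹ) t →
                eval M (λ x → k M.*ₗ f x) t M.≈ᴹ k M.*ₗ eval M f t
      eval-*ₗ k f (gen x) = M.≈ᴹ-refl
      eval-*ₗ k f 𝟎       = M.≈ᴹ-sym (M.*ₗ-zeroʳ k)
      eval-*ₗ k f (s ⊕ t) =
        M.≈ᴹ-trans (M.+ᴹ-cong (eval-*ₗ k f s) (eval-*ₗ k f t)) (M.≈ᴹ-sym (M.*ₗ-distribˡ k _ _))
      eval-*ₗ k f (l ⊛ t) = M.≈ᴹ-trans (M.*ₗ-congˡ (eval-*ₗ k f t))
        (M.≈ᴹ-trans (M.≈ᴹ-sym (M.*ₗ-assoc l k _))
        (M.≈ᴹ-trans (M.*ₗ-congʳ (R.*-comm l k)) (M.*ₗ-assoc k l _)))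

  private
    K = TensorUnit.leftModule {R = R.ring}
    module D = LeftModule GradedDual
    open CommutativeSemigroupProperties R.*-commutativeSemigroup using (x∙yz≈y∙xz)

  -- By definition `φ ∗ ψ` at `t` evaluates the tensor term `Δ ⟨$⟩ t` under the assignment `(x , y)`
  -- to `φ x * ψ y`. This law and the bilinearity laws below thus reduce to ring laws on generators
  -- and linearity of `eval` in the assignment.
  ∗-cong : ∀ {φ φ′ ψ ψ′} → φ ≈* φ′ → ψ ≈* ψ′ → φ ∗ ψ ≈* φ′ ∗ ψ′
  ∗-cong φ≈ ψ≈ t = eval-cong K (λ (x , y) → R.*-cong (φ≈ x) (ψ≈ y)) (Δ ⟨$⟩ t)

  ∗-zeroˡ : ∀ ψ → D.0ᴹ ∗ ψ ≈* D.0ᴹ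
  ∗-zeroˡ ψ t = R.trans (eval-cong K (λ _ → R.zeroˡ _) (Δ ⟨$⟩ t)) (eval-0ᴹ K (Δ ⟨$⟩ t))

  ∗-zeroʳ : ∀ φ → φ ∗ D.0ᴹ ≈* D.0ᴹ
  ∗-zeroʳ φ t = R.trans (eval-cong K (λ _ → R.zeroʳ _) (Δ ⟨$⟩ t)) (eval-0ᴹ K (Δ ⟨$⟩ t))

  ∗-distribʳ : ∀ φ φ′ ψ → (φ D.+ᴹ φ′) ∗ ψ ≈* φ ∗ ψ D.+ᴹ φ′ ∗ ψ
  ∗-distribʳ φ φ′ ψ t = R.trans (eval-cong K (λ _ → R.distribʳ _ _ _) (Δ ⟨$⟩ t))
    (eval-+ᴹ K _ _ (Δ ⟨$⟩ t))

  ∗-distribˡ : ∀ φ ψ ψ′ → φ ∗ (ψ D.+ᴹ ψ′) ≈* φ ∗ ψ D.+ᴹ φ ∗ ψ′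
  ∗-distribˡ φ ψ ψ′ t = R.trans (eval-cong K (λ _ → R.distribˡ _ _ _) (Δ ⟨$⟩ t))
    (eval-+ᴹ K _ _ (Δ ⟨$⟩ t))

  ∗-*ₗˡ : ∀ k φ ψ → (k D.*ₗ φ) ∗ ψ ≈* k D.*ₗ (φ ∗ ψ)
  ∗-*ₗˡ k φ ψ t = R.trans (eval-cong K (λ _ → R.*-assoc _ _ _) (Δ ⟨$⟩ t))
    (eval-*ₗ K k _ (Δ ⟨$⟩ t))

  ∗-*ₗʳ : ∀ k φ ψ → φ ∗ (k D.*ₗ ψ) ≈* k D.*ₗ (φ ∗ ψ)
  ∗-*ₗʳ k φ ψ t = R.trans (eval-cong K (λ _ → x∙yz≈y∙xz _ _ _) (Δ ⟨$⟩ t))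
    (eval-*ₗ K k _ (Δ ⟨$⟩ t))

  -- `F-∗` expands the product over `p ⋒ q`, all of whose members are level 2.
  F-∗-span : ∀ {p q} → Level2 p → Level2 q → Level2Span-F (F p ∗ F q)
  F-∗-span {p} {q} lp lq = resp (D.≈ᴹ-sym {F p ∗ F q} {sumᴹ GradedDual F (p ⋒ q)} (F-∗ p q))
    (sumᴹ-span GradedDual _ F (p ⋒ q) λ {c} c∈ → gen (c , ⋒-level2⁺ p q c∈ lp lq))

  -- Bilinearity is used one argument at a time: first the right factor varies with the left one a
  -- basis element, then `∗-span` lets the left one vary.
  F∗-span : ∀ {p ψ} → Level2 p → Level2Span-F ψ → Level2Span-F (F p ∗ ψ)
  F∗-span lp (gen (_ , lq)) = F-∗-span lp lq
  F∗-span {p} lp zero       = resp (λ t → R.sym (∗-zeroʳ (F p) t)) zero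
  F∗-span {p} lp (add {x} {y} sx sy) =
    resp (λ t → R.sym (∗-distribˡ (F p) x y t)) (add (F∗-span lp sx) (F∗-span lp sy))
  F∗-span {p} lp (smul k {x} sx) =
    resp (λ t → R.sym (∗-*ₗʳ k (F p) x t)) (smul k (F∗-span lp sx))
  F∗-span {p} lp (resp {x} {y} x≈y sx) =
    resp (∗-cong {F p} {F p} {x} {y} (λ _ → R.refl) x≈y) (F∗-span lp sx)

  ∗-span : ∀ {φ ψ} → Level2Span-F φ → Level2Span-F ψ → Level2Span-F (φ ∗ ψ)
  ∗-span (gen (_ , lp)) sψ = F∗-span lp sψ
  ∗-span {ψ = ψ} zero sψ   = resp (λ t → R.sym (∗-zeroˡ ψ t)) zero
  ∗-span {ψ = ψ} (add {x} {y} sx sy) sψ =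
    resp (λ t → R.sym (∗-distribʳ x y ψ t)) (add (∗-span sx sψ) (∗-span sy sψ))
  ∗-span {ψ = ψ} (smul k {x} sx) sψ =
    resp (λ t → R.sym (∗-*ₗˡ k x ψ t)) (smul k (∗-span sx sψ))
  ∗-span {ψ = ψ} (resp {x} {y} x≈y sx) sψ =
    resp (∗-cong {x} {y} {ψ} {ψ} x≈y (λ _ → R.refl)) (∗-span sx sψ)

  -- Linearity of `Δ` leaves the generators. There the terms are indexed by `factorisations c`, and
  -- both parts of each factorisation inherit level 2 from `c`.
  Δ-span : ∀ {x} → Level2Span-G x →
           Span (PQSym² ⊗ PQSym²) {I = ∃ Level2Span-G × ∃ Level2Span-G}
                (λ ((y , _) , (z , _)) → gen (y , z)) (Δ ⟨$⟩ x)
  Δ-span (gen (c , lc)) = sumᴹ-span (PQSym² ⊗ PQSym²) _ _ (factorisations c) λ {(p , q)} pq∈ →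
    let lp , lq = ⋒-level2⁻ p q (∈-factorisations⁻ pq∈) lc
    in gen ((G p , gen (p , lp)) , (G q , gen (q , lq)))
  Δ-span zero           = zero
  Δ-span (add sx sy)    = add (Δ-span sx) (Δ-span sy)
  Δ-span (smul k sx)    = smul k (Δ-span sx)
  Δ-span (resp x≈y sx)  = resp (LinearMap.⟦⟧-cong Δ x≈y) (Δ-span sx)

theorem8p1 : ∀ {r ℓr} (R : CommutativeRing r ℓr) →
    let open PQSym R in
    IsSubalgebra GradedDual _∗_ 1* Level2Span-F
    × IsSubcoalgebra PQSym² Δ Level2Span-G
theorem8p1 R = record
    { isSubmodule = span-isSubmodule R GradedDual _
    ; 1ᴹ-closed   = gen (∅ , ∅-level2)
    ; ·-closed    = ∗-span R
    } , record
    { isSubmodule = span-isSubmodule R PQSym² _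
    ; Δ-closed    = Δ-span R
    }
  where open PQSym R
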